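{- For every sufficiently large positive integer $n$, there exists a string $W$ of length $n$ (over some totally ordered alphabet) such that $v(W)/z(W) \in \Omega(\log n)$. That is, there exist constants $\kappa>0$ and $n_0$ such that for every integer $n\ge n_0$ there are a totally ordered alphabet $(\Sigma,\prec)$ and a string $W\in\Sigma^n$ with $v_\prec(W)\ge \kappa \log n\cdot z(W)$.
   Context: The alphabet and its order may depend on $n$. Strings are indexed from $0$: a string $S$ of length $n=|S|$ is $S[0]\cdots S[n-1]$, and $S[i..j]$ is the substring from position $i$ to position $j$. A factorization of $S$ is a sequence of nonempty strings (phrases) $F_1,\dots,F_m$ with $S=F_1\cdots F_m$; the starting position of $F_i$ is $b_i=\sum_{k=1}^{i-1}|F_k|$. The Lempel--Ziv (LZ) factorization of $S$ is built from left to right: if the character $S[b_i]$ has no occurrence in $S$ starting before $b_i$, then $F_i=S[b_i]$; otherwise $F_i$ is the longest prefix of $S[b_i..n-1]$ that has an occurrence in $S$ starting before $b_i$ (this earlier occurrence may overlap $F_i$). The number of its phrases is denoted $z(S)$. Let $\prec$ be a total order on $\Sigma$, extended to the lexicographic order on $\Sigma^*$ (a proper prefix of a string is smaller than the string). Let $\mathrm{LCP}(X,Y)$ be the length of the longest common prefix of $X$ and $Y$. The lex-parse of $S$ with respect to $\prec$ is the factorization $F_1,\dots,F_m$ built from left to right as follows: let $\ell_i$ be the maximum of $\mathrm{LCP}(S[b_i..n-1],S[p..n-1])$ over all positions $0\le p<n$ with $S[p..n-1]\prec S[b_i..n-1]$, and $\ell_i=0$ if no such $p$ exists; then $F_i=S[b_i..b_i+\max\{\ell_i,1\}-1]$.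 The number of its phrases is denoted $v_\prec(S)$, or $v(S)$. -}

module Defs where

open import Level using (0ℓ)
open import Data.Bool using (if_then_else_)
open import Data.Nat using (ℕ; zero; suc; _+_; _*_; _∸_; _^_; _≤_; _<_; _⊔_; _<?_; s≤s)
open import Data.Nat.Properties using (anyUpTo?; ≤-refl; ≤-reflexive; ≤-trans; m≤n⊔m;
  ∸-monoʳ-≤; ∸-monoˡ-≤; ∸-+-assoc; m<n⇒0<n∸m; ≮⇒≥; m≤n⇒m∸n≡0; n≤0⇒n≡0)
open import Data.Integer using (∣_∣)
open import Data.Rational using (ℚ; ↥_; ↧ₙ_)
open import Data.Product using (∃; _×_; _,_)
open import Data.Sum using (inj₂)
open import Data.List using (List; []; _∷_; _++_; length; take; drop; map; filter; upTo; concat)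
open import Data.List.Properties using (length-drop; take++drop≡id; drop-drop)
open import Data.List.Extrema.Nat using (max; v≤max⁺)
open import Data.List.Membership.Propositional using (lose)
open import Data.List.Membership.Propositional.Properties using (∈-filter⁺; ∈-upTo⁺)
open import Data.List.Relation.Binary.Prefix.Heterogeneous using (Prefix)
open import Data.List.Relation.Binary.Prefix.Heterogeneous.Properties using (prefix?)
import Data.List.Relation.Binary.Lex.Strict as Lex
open import Relation.Nullary using (Dec; does; yes; no)
open import Relation.Binary using (Rel; Decidable; DecidableEquality; IsStrictTotalOrder)
open import Relation.Binary.PropositionalEquality

module _ {A : Set} where

  suffix : List A → ℕ → List A
  suffix S b = drop b S

  -- The phrases from position b onwards, when a phrase starting at position b
  -- has length len b.  The first argument only bounds the number of phrases.
  factorizationFrom : (len : ℕ → ℕ) → List A → ℕ → ℕ → List (List A)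
  factorizationFrom len S zero    b = []
  factorizationFrom len S (suc k) b with b <? length S
  ... | yes _ = take (len b) (suffix S b) ∷ factorizationFrom len S k (b + len b)
  ... | no  _ = []

  -- The bound length S is large enough because phrases are nonempty, as
  -- concat-factorization confirms.
  factorization : (len : ℕ → ℕ) → List A → List (List A)
  factorization len S = factorizationFrom len S (length S) 0

  length≡0⇒≡[] : {X : List A} → length X ≡ 0 → X ≡ []
  length≡0⇒≡[] {[]} _ = refl

  concat-factorizationFrom : ∀ len S → (∀ b → b < length S → 1 ≤ len b) →
    ∀ k b → length S ∸ b ≤ k → concat (factorizationFrom len S k b) ≡ suffix S b
  concat-factorizationFrom len S pos zero b n∸b≤0 =
    sym (length≡0⇒≡[] (trans (length-drop b S) (n≤0⇒n≡0 n∸b≤0)))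
  concat-factorizationFrom len S pos (suc k) b n∸b≤1+k with b <? length S
  ... | no b≮n = sym (length≡0⇒≡[] (trans (length-drop b S) (m≤n⇒m∸n≡0 (≮⇒≥ b≮n))))
  ... | yes b<n = begin
    take (len b) (suffix S b) ++ concat (factorizationFrom len S k (b + len b))
      ≡⟨ cong (take (len b) (suffix S b) ++_)
           (concat-factorizationFrom len S pos k (b + len b) bound) ⟩
    take (len b) (suffix S b) ++ suffix S (b + len b)
      ≡⟨ cong (take (len b) (suffix S b) ++_) (drop-drop b (len b) S) ⟨
    take (len b) (suffix S b) ++ drop (len b) (suffix S b)
      ≡⟨ take++drop≡id (len b) (suffix S b) ⟩
    suffix S b ∎
    where
    open ≡-Reasoning
    bound : length S ∸ (b + len b) ≤ k
    bound = ≤-trans (≤-reflexive (sym (∸-+-assoc (length S) b (len b))))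
           (≤-trans (∸-monoʳ-≤ (length S ∸ b) (pos b b<n))
                    (∸-monoˡ-≤ 1 n∸b≤1+k))

  concat-factorization : ∀ len S → (∀ b → b < length S → 1 ≤ len b) →
    concat (factorization len S) ≡ S
  concat-factorization len S pos = concat-factorizationFrom len S pos (length S) 0 ≤-refl

module LZ {A : Set} (_≟_ : DecidableEquality A) where

  OccursBefore : List A → ℕ → List A → Set
  OccursBefore S b X = ∃ λ p → p < b × Prefix _≡_ X (suffix S p)

  occursBefore? : ∀ S b X → Dec (OccursBefore S b X)
  occursBefore? S b X = anyUpTo? (λ p → prefix? _≟_ X (suffix S p)) b

  -- The length of the longest prefix of S[b..] that occurs before b.
  longestPrefix : List A → ℕ → ℕ
  longestPrefix S b =
    max 0 (filter (λ ℓ → occursBefore? S b (take ℓ (suffix S b)))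
                  (upTo (suc (length S ∸ b))))

  -- For b < length S, take 1 (suffix S b) is the one-character string S[b].
  phraseLength : List A → ℕ → ℕ
  phraseLength S b =
    if does (occursBefore? S b (take 1 (suffix S b)))
    then longestPrefix S b
    else 1

  phrases : List A → List (List A)
  phrases S = factorization (phraseLength S) S

  1≤phraseLength : ∀ S b → b < length S → 1 ≤ phraseLength S b
  1≤phraseLength S b b<n with occursBefore? S b (take 1 (suffix S b))
  ... | no  _   = ≤-refl
  ... | yes occ = v≤max⁺ 0 _ (inj₂ (lose
    (∈-filter⁺ (λ k → occursBefore? S b (take k (suffix S b)))
      (∈-upTo⁺ (s≤s (m<n⇒0<n∸m b<n))) occ)
    ≤-refl))

  concat-phrases : ∀ S → concat (phrases S) ≡ S
  concat-phrases S = concat-factorization (phraseLength S) S (1≤phraseLength S)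

  z : List A → ℕ
  z S = length (phrases S)

module LexParse {A : Set} {_≺_ : Rel A 0ℓ} (O : IsStrictTotalOrder _≡_ _≺_) where

  open IsStrictTotalOrder O using (_≟_) renaming (_<?_ to _≺?_)

  infix 4 _≺*_ _≺*?_

  _≺*_ : Rel (List A) 0ℓ
  _≺*_ = Lex.Lex-< _≡_ _≺_

  _≺*?_ : Decidable _≺*_
  _≺*?_ = Lex.<-decidable _≟_ _≺?_

  LCP : List A → List A → ℕ
  LCP (x ∷ X) (y ∷ Y) = if does (x ≟ y) then suc (LCP X Y) else 0
  LCP _       _       = 0

  -- The seed 0 of max gives the value when no suffix is smaller.
  ℓ : List A → ℕ → ℕ
  ℓ S b =
    max 0 (map (λ p → LCP (suffix S b) (suffix S p))
               (filter (λ p → suffix S p ≺*? suffix S b) (upTo (length S))))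

  phraseLength : List A → ℕ → ℕ
  phraseLength S b = ℓ S b ⊔ 1

  phrases : List A → List (List A)
  phrases S = factorization (phraseLength S) S

  concat-phrases : ∀ S → concat (phrases S) ≡ S
  concat-phrases S =
    concat-factorization (phraseLength S) S (λ b _ → m≤n⊔m (ℓ S b) 1)

  v : List A → ℕ
  v S = length (phrases S)

-- x ≥ κ · log₂ n · y for κ > 0 and n > 0: writing κ = p / q, this is
-- q · x ≥ p · y · log₂ n, and both sides are then exponentiated to base 2.
-- The base of the logarithm only rescales κ.
_≥_·log₂_·_ : ℕ → ℚ → ℕ → ℕ → Set
x ≥ κ ·log₂ n · y = n ^ (∣ ↥ κ ∣ * y) ≤ 2 ^ (↧ₙ κ * x)

{-# OPTIONS --safe #-}
-- Let M = F₂ₖ₊₂ and β = F₂ₖ₊₁ be consecutive Fibonacci numbers and rot j = j β mod M.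
-- W consists of M blocks with offsets h = M, …, 1, where the position at distance j
-- from the end of its block carries the letter h + rot j for 0 < j < 2M, and each
-- block begins with the smallest letter 0; zeros pad W to length n.
--
-- LZ needs at most four phrases for a block after the first: both halves are equal,
-- and a block takes its first half from the preceding block, because
-- h + rot j = (h + 1) + rot (j + u) whenever u β ≡ − 1 (mod M) and M does not divide j.
--
-- The lex-parse needs k phrases for a block.  Two occurrences of a letter in blocks
-- with offsets h′ < h are followed by equal letters until the one in the block h′
-- meets a letter below h, or until either block ends.  The multiples of β come close
-- to 0 modulo M from both sides at the Fibonacci numbers, and this brings such an
-- event early: the suffix at distance F₂ᵢ₊₃ from the end of its block shares at most
-- F₂ᵢ₊₂ letters with any smaller suffix, hence a phrase that starts at or before this
-- distance ends at or before the distance F₂ᵢ₊₁.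
--
-- As n is polynomial in M, its logarithm is proportional to k.
module Submission where

open import Defs
open import Level using (0ℓ)
open import Data.Nat using (ℕ; zero; suc; _+_; _*_; _∸_; _^_; _%_; _≤_; _<_; _≮_; z≤n; s≤s;
  _<?_; _≤?_; NonZero; >-nonZero)
open import Data.Nat.Properties hiding (_≟_)
open import Data.Nat.DivMod using (m%n<n; m%n≤m; m<n⇒m%n≡m; [m+n]%n≡m%n; [m+kn]%n≡m%n; %-distribˡ-+)
open import Data.Nat.Tactic.RingSolver using (solve-∀)
import Data.Integer as ℤ
open import Data.Rational using (ℚ; 0ℚ; _>_; _/_; *<*)
open import Data.Empty using (⊥; ⊥-elim)
open import Data.Product using (∃; _×_; _,_; proj₁; proj₂)
open import Data.Sum using (_⊎_; inj₁; inj₂)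
open import Data.List using (List; []; _∷_; length; take; drop)
open import Data.List.Extrema.Nat using (max≤v⁺; v≤max⁺)
open import Data.List.Membership.Propositional using (lose)
open import Data.List.Membership.Propositional.Properties using (∈-filter⁺; ∈-filter⁻; ∈-upTo⁺; ∈-upTo⁻)
import Data.List.Relation.Unary.All as All
open import Data.List.Relation.Unary.All.Properties using (map⁺)
open import Data.List.Relation.Binary.Prefix.Heterogeneous using (Prefix; []; _∷_)
open import Data.List.Relation.Binary.Lex.Strict using (base; halt; this; next)
open import Relation.Nullary using (yes; no; contradiction)
open import Relation.Binary using (Rel; DecidableEquality; IsStrictTotalOrder; tri<; tri≈; tri>)
open import Relation.Binary.PropositionalEquality

-- Counting the phrases of a factorization

module _ {A : Set} (len : ℕ → ℕ) (S : List A) where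

  -- Every start from m on is allowed, because a phrase boundary need not fall on m itself; in
  -- `AtLeast` likewise every start up to m. This lets the bounds be chained along positions chosen
  -- in advance.
  AtMost : ℕ → ℕ → Set
  AtMost m R = ∀ b k → m ≤ b → length (factorizationFrom len S k b) ≤ R

  AtLeast : ℕ → ℕ → Set
  AtLeast m R = ∀ b k → b ≤ m → length S ≤ b + k → R ≤ length (factorizationFrom len S k b)

  atMost-end : AtMost (length S) 0
  atMost-end b zero    n≤b = z≤n
  atMost-end b (suc k) n≤b with b <? length S
  ... | yes b<n = contradiction n≤b (<⇒≱ b<n)
  ... | no  _   = z≤n

  atMost-step : ∀ {m m′ R} → (∀ b → m ≤ b → b < m′ → b < length S → m′ ≤ b + len b) →
    AtMost m′ R → AtMost m (suc R)
  atMost-step reach rest b zero    m≤b = z≤n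
  atMost-step {m′ = m′} reach rest b (suc k) m≤b with b <? length S
  ... | no  _   = z≤n
  ... | yes b<n with b <? m′
  ...   | yes b<m′ = s≤s (rest (b + len b) k (reach b m≤b b<m′ b<n))
  ...   | no  b≮m′ = s≤s (rest (b + len b) k (≤-trans (≮⇒≥ b≮m′) (m≤m+n b (len b))))

  -- The phrase at b cannot pass m′, so the count for m′ applies after it. A phrase uses one unit of
  -- fuel and advances by at least one position, so the fuel stays sufficient.
  atLeast-step : (∀ b → 1 ≤ len b) → ∀ {m m′ R} → m < length S →
    (∀ b → b ≤ m → b + len b ≤ m′) → AtLeast m′ R → AtLeast m (suc R)
  atLeast-step pos m<n bound rest b zero b≤m n≤b+0 =
    contradiction (subst (length S ≤_) (+-identityʳ b) n≤b+0) (<⇒≱ (≤-<-trans b≤m m<n))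
  atLeast-step pos m<n bound rest b (suc k) b≤m n≤b+k with b <? length S
  ... | no  b≮n = contradiction (≤-<-trans b≤m m<n) b≮n
  ... | yes _   = s≤s (rest (b + len b) k (bound b b≤m) fuel)
    where
    open ≤-Reasoning
    fuel : length S ≤ b + len b + k
    fuel = begin
      length S        ≤⟨ n≤b+k ⟩
      b + (1 + k)     ≡⟨ +-assoc b 1 k ⟨
      b + 1 + k       ≤⟨ +-monoˡ-≤ k (+-monoʳ-≤ b (pos b)) ⟩
      b + len b + k   ∎

-- Words given by a letter function

module _ {A : Set} (w : ℕ → A) where

  segment : ℕ → ℕ → List A
  segment b zero    = []
  segment b (suc k) = w b ∷ segment (suc b) k

  length-segment : ∀ b k → length (segment b k) ≡ k
  length-segment b zero    = refl
  length-segment b (suc k) = cong suc (length-segment (suc b) k)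

  drop-segment : ∀ c b k → drop c (segment b k) ≡ segment (c + b) (k ∸ c)
  drop-segment zero    b k       = refl
  drop-segment (suc c) b zero    = refl
  drop-segment (suc c) b (suc k) =
    trans (drop-segment c (suc b) k) (cong (λ a → segment a (k ∸ c)) (+-suc c b))

  take-segment : ∀ {c k} b → c ≤ k → take c (segment b k) ≡ segment b c
  take-segment b z≤n       = refl
  take-segment b (s≤s c≤k) = cong (w b ∷_) (take-segment (suc b) c≤k)

  Agree : ℕ → ℕ → ℕ → Set
  Agree m p c = ∀ s → s < c → w (m + s) ≡ w (p + s)

  agree-head : ∀ {m p c} → Agree m p (suc c) → w m ≡ w p
  agree-head {m} {p} eq = subst₂ (λ i j → w i ≡ w j) (+-identityʳ m) (+-identityʳ p) (eq 0 (s≤s z≤n))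

  agree-tail : ∀ {m p c} → Agree m p (suc c) → Agree (suc m) (suc p) c
  agree-tail {m} {p} eq s s<c = subst₂ (λ i j → w i ≡ w j) (+-suc m s) (+-suc p s) (eq (suc s) (s≤s s<c))

  agree-cons : ∀ {m p c} → w m ≡ w p → Agree (suc m) (suc p) c → Agree m p (suc c)
  agree-cons {m} {p} h t zero    _         = subst₂ (λ i j → w i ≡ w j) (sym (+-identityʳ m)) (sym (+-identityʳ p)) h
  agree-cons {m} {p} h t (suc s) (s≤s s<c) = subst₂ (λ i j → w i ≡ w j) (sym (+-suc m s)) (sym (+-suc p s)) (t s s<c)

  prefix-segment : ∀ {m p c k} → c ≤ k → Agree m p c → Prefix _≡_ (segment m c) (segment p k)
  prefix-segment z≤n       eq = []
  prefix-segment (s≤s c≤k) eq = agree-head eq ∷ prefix-segment c≤k (agree-tail eq)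

  word : ℕ → List A
  word = segment 0

  suffix-word : ∀ n b → suffix (word n) b ≡ segment b (n ∸ b)
  suffix-word n b = trans (drop-segment b 0 n) (cong (λ a → segment a (n ∸ b)) (+-identityʳ b))

  length-word : ∀ n → length (word n) ≡ n
  length-word = length-segment 0

  -- LZ phrases and earlier copies

  module _ (_≟_ : DecidableEquality A) where
    open LZ _≟_

    occursBefore-word : ∀ {n b σ c} → b + c ≤ n → σ < b → Agree b σ c →
      OccursBefore (word n) b (take c (suffix (word n) b))
    occursBefore-word {n} {b} {σ} {c} b+c≤n σ<b eq =
      σ , σ<b , subst₂ (Prefix _≡_) (sym lhs) (sym (suffix-word n σ)) (prefix-segment c≤n∸σ eq)
      where
      c≤n∸b : c ≤ n ∸ b
      c≤n∸b = subst (_≤ n ∸ b) (m+n∸m≡n b c) (∸-monoˡ-≤ b b+c≤n)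
      c≤n∸σ : c ≤ n ∸ σ
      c≤n∸σ = ≤-trans c≤n∸b (∸-monoʳ-≤ n (<⇒≤ σ<b))
      lhs : take c (suffix (word n) b) ≡ segment b c
      lhs = trans (cong (take c) (suffix-word n b)) (take-segment b c≤n∸b)

    -- The copy contains the first letter, which excludes the case of a fresh letter; its length is
    -- then a candidate for the maximum.
    phraseLength-copy : ∀ {n b σ c} → b + suc c ≤ n → σ < b → Agree b σ (suc c) →
      suc c ≤ phraseLength (word n) b
    phraseLength-copy {n} {b} {σ} {c} b+c≤n σ<b eq
      with occursBefore? (word n) b (take 1 (suffix (word n) b))
    ... | yes _ = v≤max⁺ 0 _ (inj₂ (lose
          (∈-filter⁺ (λ k → occursBefore? (word n) b (take k (suffix (word n) b)))
            (∈-upTo⁺ (s≤s c≤)) (occursBefore-word b+c≤n σ<b eq)) ≤-refl))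
      where
      c≤ : suc c ≤ length (word n) ∸ b
      c≤ = subst (_≤ length (word n) ∸ b) (m+n∸m≡n b (suc c))
             (∸-monoˡ-≤ b (subst (b + suc c ≤_) (sym (length-word n)) b+c≤n))
    ... | no ¬occ = contradiction
          (occursBefore-word (≤-trans (+-monoʳ-≤ b (s≤s z≤n)) b+c≤n) σ<b
            λ s s<1 → eq s (≤-trans s<1 (s≤s z≤n))) ¬occ

    LZAtMost : ℕ → ℕ → ℕ → Set
    LZAtMost n = AtMost (phraseLength (word n)) (word n)

    lzAtMost-end : ∀ n → LZAtMost n n 0
    lzAtMost-end n = subst (λ l → LZAtMost n l 0) (length-word n) (atMost-end (phraseLength (word n)) (word n))

    lzAtMost-letter : ∀ {n m R} → LZAtMost n (suc m) R → LZAtMost n m (suc R)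
    lzAtMost-letter {n} {m} = atMost-step (phraseLength (word n)) (word n) λ b m≤b b<1+m b<n →
      ≤-trans (s≤s m≤b) (subst (_≤ b + phraseLength (word n) b) (+-comm b 1)
        (+-monoʳ-≤ b (1≤phraseLength (word n) b b<n)))

    lzAtMost-letters : ∀ {n m R} d → LZAtMost n (d + m) R → LZAtMost n m (d + R)
    lzAtMost-letters         zero    h = h
    lzAtMost-letters {n} {m} {R} (suc d) h = lzAtMost-letter
      (lzAtMost-letters d (subst (λ i → LZAtMost n i R) (sym (+-suc d m)) h))

    -- A phrase that starts d positions into the stretch can copy the remainder from `σ + d`, so it
    -- reaches the end of the stretch and at most one phrase starts inside.
    lzAtMost-copy : ∀ {n m σ c R} → m + c ≤ n → σ < m → Agree m σ c →
      LZAtMost n (m + c) R → LZAtMost n m (suc R)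
    lzAtMost-copy {n} {m} {σ} {c} m+c≤n σ<m eq =
      atMost-step (phraseLength (word n)) (word n) reach
      where
      reach : ∀ b → m ≤ b → b < m + c → b < length (word n) → m + c ≤ b + phraseLength (word n) b
      reach b m≤b b<m+c _ with m≤n⇒∃[o]m+o≡n m≤b | m≤n⇒∃[o]m+o≡n b<m+c
      ... | d , refl | e , m+d+e≡m+c = subst (_≤ m + d + phraseLength (word n) (m + d)) end
        (+-monoʳ-≤ (m + d) (phraseLength-copy (subst (_≤ n) (sym end) m+c≤n) (+-monoˡ-< d σ<m) eq′))
        where
        end : m + d + suc e ≡ m + c
        end = trans (+-suc (m + d) e) m+d+e≡m+c
        eq′ : Agree (m + d) (σ + d) (suc e)
        eq′ s s<e = subst₂ (λ i j → w i ≡ w j) (sym (+-assoc m d s)) (sym (+-assoc σ d s))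
          (eq (d + s) (+-cancelˡ-< m (d + s) c (subst₂ _<_ (+-assoc m d s) end (+-monoʳ-< (m + d) s<e))))

  -- Lex-parse phrases and smaller suffixes

  module _ {_≺_ : Rel A 0ℓ} (O : IsStrictTotalOrder _≡_ _≺_) where
    open LexParse O
    open IsStrictTotalOrder O using (_≟_)

    -- The suffix of word n at p is smaller than the one at m, and c is their LCP.
    Below : ℕ → ℕ → ℕ → ℕ → Set
    Below n m p c = Agree m p c × m + c < n × p + c ≤ n × (p + c < n → w (p + c) ≺ w (m + c))

    -- The smaller segment may be a proper prefix of the larger one and end where they part, but the
    -- larger one must still have a letter there. Hence only the bound by k′ is strict.
    below-segment : ∀ {m p k k′} → segment p k ≺* segment m k′ →
      let c = LCP (segment m k′) (segment p k) in
      Agree m p c × c < k′ × c ≤ k × (c < k → w (p + c) ≺ w (m + c))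
    below-segment {k = zero}  {zero}   (base ())
    below-segment {k = zero}  {suc k′} halt = (λ _ ()) , s≤s z≤n , z≤n , λ ()
    below-segment {m} {p} {suc k} {suc k′} p≺m with w m ≟ w p | p≺m
    ... | yes m≡p | this wp≺wm = contradiction wp≺wm (IsStrictTotalOrder.irrefl O (sym m≡p))
    ... | no  m≢p | next p≡m _ = contradiction (sym p≡m) m≢p
    ... | no  m≢p | this wp≺wm =
      (λ _ ()) , s≤s z≤n , z≤n , λ _ → subst₂ (λ i j → w i ≺ w j) (sym (+-identityʳ p)) (sym (+-identityʳ m)) wp≺wm
    ... | yes m≡p | next _ rest with below-segment {suc m} {suc p} {k} {k′} rest
    ...   | eq , c<k′ , c≤k , wp≺wm =
      agree-cons m≡p eq , s≤s c<k′ , s≤s c≤k ,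
      λ { (s≤s c<k) → subst₂ (λ i j → w i ≺ w j) (sym (+-suc p _)) (sym (+-suc m _)) (wp≺wm c<k) }

    below-suffix : ∀ {n b p} → b < n → p < n → suffix (word n) p ≺* suffix (word n) b →
      Below n b p (LCP (suffix (word n) b) (suffix (word n) p))
    below-suffix {n} {b} {p} b<n p<n p≺b rewrite suffix-word n b | suffix-word n p
      with below-segment {b} {p} {n ∸ p} {n ∸ b} p≺b
    ... | eq , c<n∸b , c≤n∸p , less =
      eq ,
      subst (b + c <_) (m+[n∸m]≡n (<⇒≤ b<n)) (+-monoʳ-< b c<n∸b) ,
      subst (p + c ≤_) p+[n∸p]≡n (+-monoʳ-≤ p c≤n∸p) ,
      λ p+c<n → less (+-cancelˡ-< p c (n ∸ p) (subst (p + c <_) (sym p+[n∸p]≡n) p+c<n))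
      where
      c = LCP (segment b (n ∸ b)) (segment p (n ∸ p))
      p+[n∸p]≡n = m+[n∸m]≡n (<⇒≤ p<n)

    below-shift : ∀ {n m p c} d → Below n m p (d + c) → Below n (m + d) (p + d) c
    below-shift {n} {m} {p} {c} d (eq , m<n , p≤n , less) =
      (λ s s<c → subst₂ (λ i j → w i ≡ w j) (sym (+-assoc m d s)) (sym (+-assoc p d s)) (eq (d + s) (+-monoʳ-< d s<c))) ,
      subst (_< n) (sym (+-assoc m d c)) m<n ,
      subst (_≤ n) (sym (+-assoc p d c)) p≤n ,
      λ h → subst₂ (λ i j → w i ≺ w j) (sym (+-assoc p d c)) (sym (+-assoc m d c)) (less (subst (_< n) (+-assoc p d c) h))

    phraseLength-bound : ∀ {n b D} → b < n → 1 ≤ D → (∀ p c → Below n b p c → c ≤ D) →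
      phraseLength (word n) b ≤ D
    phraseLength-bound {n} {b} {D} b<n 1≤D bound =
      ⊔-lub (max≤v⁺ z≤n (map⁺ (All.tabulate λ p∈ →
        let p∈upTo , p≺b = ∈-filter⁻ (λ p → suffix (word n) p ≺*? suffix (word n) b) p∈
        in bound _ _ (below-suffix b<n (subst (_ <_) (length-word n) (∈-upTo⁻ p∈upTo)) p≺b)))) 1≤D

    -- A phrase that starts before m and reaches beyond m + D would make, after
    -- removing the common prefix of length m ∸ b, a phrase at m longer than D.
    phrase-stops : ∀ {n m D} → m < n → 1 ≤ D → (∀ p c → Below n m p c → c ≤ D) →
      ∀ b → b ≤ m → b + phraseLength (word n) b ≤ m + D
    phrase-stops {n} {m} {D} m<n 1≤D bound b b≤m with m≤n⇒∃[o]m+o≡n b≤m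
    ... | d , refl = subst (b + phraseLength (word n) b ≤_) (sym (+-assoc b d D))
      (+-monoʳ-≤ b (phraseLength-bound (≤-<-trans b≤m m<n) (≤-trans 1≤D (m≤n+m D d)) stop))
      where
      stop : ∀ p c → Below n b p c → c ≤ d + D
      stop p c below with ≤-total c d
      ... | inj₁ c≤d = ≤-trans c≤d (m≤m+n d D)
      ... | inj₂ d≤c with m≤n⇒∃[o]m+o≡n d≤c
      ...   | c′ , refl = +-monoʳ-≤ d (bound _ c′ (below-shift d below))

-- Multiples of a number modulo M

module Rotation (M β : ℕ) .{{_ : NonZero M}} where

  rot : ℕ → ℕ
  rot t = (t * β) % M

  rot< : ∀ t → rot t < M
  rot< t = m%n<n (t * β) M

  rot-+ : ∀ s t → rot (s + t) ≡ (rot s + rot t) % M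
  rot-+ s t = trans (cong (_% M) (*-distribʳ-+ β s t)) (%-distribˡ-+ (s * β) (t * β) M)

  rot-+-≤ : ∀ s t → rot (s + t) ≤ rot s + rot t
  rot-+-≤ s t = subst (_≤ rot s + rot t) (sym (rot-+ s t)) (m%n≤m (rot s + rot t) M)

  rot-+-small : ∀ s t → rot s + rot t < M → rot (s + t) ≡ rot s + rot t
  rot-+-small s t sum<M = trans (rot-+ s t) (m<n⇒m%n≡m sum<M)

  rot-+-large : ∀ s t → M ≤ rot s + rot t → rot (s + t) + M ≡ rot s + rot t
  rot-+-large s t M≤sum with m≤n⇒∃[o]m+o≡n M≤sum
  ... | d , M+d≡sum = begin
    rot (s + t) + M           ≡⟨ cong (_+ M) (rot-+ s t) ⟩
    (rot s + rot t) % M + M   ≡⟨ cong (λ x → x % M + M) M+d≡sum ⟨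
    (M + d) % M + M           ≡⟨ cong (λ x → x % M + M) (+-comm M d) ⟩
    (d + M) % M + M           ≡⟨ cong (_+ M) ([m+n]%n≡m%n d M) ⟩
    d % M + M                 ≡⟨ cong (_+ M) (m<n⇒m%n≡m d<M) ⟩
    d + M                     ≡⟨ +-comm d M ⟩
    M + d                     ≡⟨ M+d≡sum ⟩
    rot s + rot t             ∎
    where
    open ≡-Reasoning
    d<M : d < M
    d<M = +-cancelˡ-< M d M (subst (_< M + M) (sym M+d≡sum) (+-mono-< (rot< s) (rot< t)))

  rot-period : ∀ t → rot (M + t) ≡ rot t
  rot-period t = begin
    (M + t) * β % M         ≡⟨ cong (_% M) (*-distribʳ-+ β M t) ⟩
    (M * β + t * β) % M     ≡⟨ cong (_% M) (+-comm (M * β) (t * β)) ⟩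
    (t * β + M * β) % M     ≡⟨ cong (λ x → (t * β + x) % M) (*-comm M β) ⟩
    (t * β + β * M) % M     ≡⟨ [m+kn]%n≡m%n (t * β) β M ⟩
    t * β % M               ∎
    where open ≡-Reasoning

-- P i and Q i are the Fibonacci numbers with index 2i + 1 and 2i.

mutual
  P : ℕ → ℕ
  P zero    = 1
  P (suc i) = P i + Q (suc i)

  Q : ℕ → ℕ
  Q zero    = 0
  Q (suc i) = P i + Q i

1≤P : ∀ i → 1 ≤ P i
1≤P zero    = ≤-refl
1≤P (suc i) = ≤-trans (1≤P i) (m≤m+n (P i) (Q (suc i)))

1≤Q : ∀ {i} → 1 ≤ i → 1 ≤ Q i
1≤Q {suc i} _ = ≤-trans (1≤P i) (m≤m+n (P i) (Q i))

P+Q≤4^ : ∀ i → P i + Q i ≤ 4 ^ i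
P+Q≤4^ zero    = ≤-refl
P+Q≤4^ (suc i) = begin
  P i + (P i + Q i) + (P i + Q i)                    ≤⟨ m≤m+n _ (P i + Q i + Q i) ⟩
  P i + (P i + Q i) + (P i + Q i) + (P i + Q i + Q i) ≡⟨ lemma (P i) (Q i) ⟩
  4 * (P i + Q i)                                    ≤⟨ *-monoʳ-≤ 4 (P+Q≤4^ i) ⟩
  4 * 4 ^ i                                          ∎
  where
  open ≤-Reasoning
  lemma : ∀ p q → p + (p + q) + (p + q) + (p + q + q) ≡ 4 * (p + q)
  lemma = solve-∀

-- Closest approaches of the Fibonacci rotation

module Fibonacci (K : ℕ) (1≤K : 1 ≤ K) where

  M : ℕ
  M = Q (suc K)

  instance
    M≢0 : NonZero M
    M≢0 = >-nonZero (1≤Q {suc K} (s≤s z≤n))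

  open Rotation M (P K) public

  -- Multiples of P K modulo M come near 0 from above at the P i and from below
  -- at the Q (suc i), and no earlier multiple comes as near.
  record Approach (i r : ℕ) : Set where
    field
      fits   : P r + Q r ≤ M
      above  : rot (P i) ≡ P r
      below  : 1 ≤ r → rot (Q (suc i)) + Q r ≡ M
      awayᴾ  : ∀ {t} → 1 ≤ t → t < P i → P r + Q r ≤ rot t × rot t + (P r + Q r) ≤ M
      awayᵠ  : ∀ {t} → 1 ≤ t → t < Q (suc i) → P r ≤ rot t × rot t + P r ≤ M

  approach-0 : Approach 0 K
  approach-0 = record
    { fits  = ≤-refl
    ; above = rot1
    ; below = λ _ → cong (_+ Q K) rot1
    ; awayᴾ = λ 1≤t t<1 → contradiction 1≤t (<⇒≱ t<1)
    ; awayᵠ = λ 1≤t t<1 → contradiction 1≤t (<⇒≱ t<1)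
    }
    where
    rot1 : rot 1 ≡ P K
    rot1 = trans (cong (_% M) (*-identityˡ (P K)))
      (m<n⇒m%n≡m (subst (_< M) (+-identityʳ (P K)) (+-monoʳ-< (P K) (1≤Q 1≤K))))

  -- One round of the Euclidean algorithm on the gaps p above 0 and q below M: adding the arguments
  -- x and y leaves the gap p - q = `P r` above, and adding y once more leaves q - `P r` = `Q r`
  -- below. An argument beyond y or x + y is this approach plus a smaller argument, whose known
  -- distances carry over.
  approach-suc : ∀ {i r} → Approach i (suc r) → Approach (suc i) r
  approach-suc {i} {r} L = record
    { fits = ≤-trans (m≤n+m (Q (suc r)) (P (suc r))) fits
    ; above = above′ ; below = below′ ; awayᴾ = awayᴾ′ ; awayᵠ = awayᵠ′ }
    where
    open Approach L
    open ≤-Reasoning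
    x = P i
    y = Q (suc i)
    p = P (suc r)
    q = Q (suc r)
    below-y : rot y + q ≡ M
    below-y = below (s≤s z≤n)
    q≤p : q ≤ p
    q≤p = m≤n+m q (P r)
    p≤rot-y : p ≤ rot y
    p≤rot-y = +-cancelʳ-≤ q p (rot y) (≤-trans fits (≤-reflexive (sym below-y)))

    above′ : rot (x + y) ≡ P r
    above′ = +-cancelʳ-≡ M (rot (x + y)) (P r) (trans (rot-+-large x y (subst (M ≤_) (sym sum) (m≤n+m M (P r)))) sum)
      where
      sum : rot x + rot y ≡ P r + M
      sum = begin-equality
        rot x + rot y      ≡⟨ cong (_+ rot y) above ⟩
        P r + q + rot y    ≡⟨ +-assoc (P r) q (rot y) ⟩
        P r + (q + rot y)  ≡⟨ cong (P r +_) (trans (+-comm q (rot y)) below-y) ⟩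
        P r + M            ∎

    awayᴾ′ : ∀ {t} → 1 ≤ t → t < x + y → q ≤ rot t × rot t + q ≤ M
    awayᴾ′ {t} 1≤t t<x+y with <-cmp t y
    ... | tri< t<y _ _ = let lo , hi = awayᵠ 1≤t t<y in
      ≤-trans q≤p lo , ≤-trans (+-monoʳ-≤ (rot t) q≤p) hi
    ... | tri≈ _ refl _ = ≤-trans q≤p p≤rot-y , ≤-reflexive below-y
    ... | tri> _ _ y<t with m≤n⇒∃[o]m+o≡n y<t
    ...   | s , refl = ≤-trans q≤p lo , hi
      where
      s<x : suc s < x
      s<x = +-cancelʳ-< y (suc s) x (subst (_< x + y) (cong suc (+-comm y s)) t<x+y)
      lo′ : p + q ≤ rot (suc s)
      lo′ = proj₁ (awayᴾ (s≤s z≤n) s<x)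
      split : rot (y + suc s) + q ≡ rot (suc s)
      split = +-cancelʳ-≡ (rot y) _ _ (begin-equality
        rot (y + suc s) + q + rot y   ≡⟨ +-assoc (rot (y + suc s)) q (rot y) ⟩
        rot (y + suc s) + (q + rot y) ≡⟨ cong (rot (y + suc s) +_) (trans (+-comm q (rot y)) below-y) ⟩
        rot (y + suc s) + M           ≡⟨ rot-+-large y (suc s) large ⟩
        rot y + rot (suc s)           ≡⟨ +-comm (rot y) (rot (suc s)) ⟩
        rot (suc s) + rot y           ∎)
        where
        large : M ≤ rot y + rot (suc s)
        large = ≤-trans (≤-reflexive (sym below-y)) (+-monoʳ-≤ (rot y) (≤-trans (m≤n+m q p) lo′))
      split′ : rot (suc y + s) + q ≡ rot (suc s)
      split′ = subst (λ t → rot t + q ≡ rot (suc s)) (+-suc y s) split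
      lo : p ≤ rot (suc y + s)
      lo = +-cancelʳ-≤ q p _ (≤-trans lo′ (≤-reflexive (sym split′)))
      hi : rot (suc y + s) + q ≤ M
      hi = ≤-trans (≤-reflexive split′) (<⇒≤ (rot< (suc s)))

    awayᵠ′ : ∀ {t} → 1 ≤ t → t < (x + y) + y → P r ≤ rot t × rot t + P r ≤ M
    awayᵠ′ {t} 1≤t t<y′ with <-cmp t (x + y)
    ... | tri< t<x+y _ _ = let lo , hi = awayᴾ′ 1≤t t<x+y in
      ≤-trans (m≤m+n (P r) (Q r)) lo , ≤-trans (+-monoʳ-≤ (rot t) (m≤m+n (P r) (Q r))) hi
    ... | tri≈ _ refl _ = ≤-reflexive (sym above′) , (begin
      rot (x + y) + P r  ≡⟨ cong (_+ P r) above′ ⟩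
      P r + P r          ≤⟨ +-monoʳ-≤ (P r) (m≤m+n (P r) (Q r)) ⟩
      p                  ≤⟨ m≤m+n p q ⟩
      p + q              ≤⟨ fits ⟩
      M                  ∎)
    ... | tri> _ _ x+y<t with m≤n⇒∃[o]m+o≡n x+y<t
    ...   | s , refl = lo , hi
      where
      s<y : suc s < y
      s<y = +-cancelˡ-< (x + y) (suc s) y (subst (_< x + y + y) (sym (+-suc (x + y) s)) t<y′)
      bounds = awayᵠ {suc s} (s≤s z≤n) s<y
      p+P≤ : rot (suc s) + P r + P r ≤ M
      p+P≤ = begin
        rot (suc s) + P r + P r    ≡⟨ +-assoc (rot (suc s)) (P r) (P r) ⟩
        rot (suc s) + (P r + P r)  ≤⟨ +-monoʳ-≤ (rot (suc s)) (+-monoʳ-≤ (P r) (m≤m+n (P r) (Q r))) ⟩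
        rot (suc s) + p            ≤⟨ proj₂ bounds ⟩
        M                          ∎
      split : rot (suc (x + y) + s) ≡ rot (suc s) + P r
      split = begin-equality
        rot (suc (x + y) + s)          ≡⟨ cong rot (trans (sym (+-suc (x + y) s)) (+-comm (x + y) (suc s))) ⟩
        rot (suc s + (x + y))          ≡⟨ rot-+-small (suc s) (x + y) small ⟩
        rot (suc s) + rot (x + y)      ≡⟨ cong (rot (suc s) +_) above′ ⟩
        rot (suc s) + P r              ∎
        where
        small : rot (suc s) + rot (x + y) < M
        small = subst (λ h → rot (suc s) + h < M) (sym above′)
          (<-≤-trans (m<m+n (rot (suc s) + P r) (1≤P r)) p+P≤)
      lo : P r ≤ rot (suc (x + y) + s)
      lo = ≤-trans (m≤n+m (P r) (rot (suc s))) (≤-reflexive (sym split))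
      hi : rot (suc (x + y) + s) + P r ≤ M
      hi = ≤-trans (≤-reflexive (cong (_+ P r) split)) p+P≤

    -- A positive `Q r` keeps the sum of the rotations below M; for r = 0 it would equal M and wrap
    -- to 0.
    below′ : 1 ≤ r → rot ((x + y) + y) + Q r ≡ M
    below′ 1≤r = trans (cong (_+ Q r) (rot-+-small (x + y) y small)) sum
      where
      sum : rot (x + y) + rot y + Q r ≡ M
      sum = begin-equality
        rot (x + y) + rot y + Q r  ≡⟨ cong (λ h → h + rot y + Q r) above′ ⟩
        P r + rot y + Q r          ≡⟨ cong (_+ Q r) (+-comm (P r) (rot y)) ⟩
        rot y + P r + Q r          ≡⟨ +-assoc (rot y) (P r) (Q r) ⟩
        rot y + q                  ≡⟨ below-y ⟩
        M                          ∎
      small : rot (x + y) + rot y < M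
      small = subst (rot (x + y) + rot y <_) sum (m<m+n _ (1≤Q 1≤r))

  approach : ∀ i r → i + r ≡ K → Approach i r
  approach zero    r refl = approach-0
  approach (suc i) r i+r≡K = approach-suc (approach i (suc r) (trans (+-suc i r) i+r≡K))

  -- Positive arguments below `P i` have rotations so far from both 0 and M that adding `P i` never
  -- wraps around, whereas adding `Q (suc i)` always does, as `jump-below` states.
  jump-above : ∀ {i t} → i < K → 1 ≤ t → t < P i → rot (t + P i) ≡ rot t + rot (P i)
  jump-above {i} {t} i<K 1≤t t<P with m≤n⇒∃[o]m+o≡n i<K
  ... | r , 1+i+r≡K = rot-+-small t (P i) (<-≤-trans less (proj₂ (awayᴾ 1≤t t<P)))
    where
    open Approach (approach i (suc r) (trans (+-suc i r) 1+i+r≡K))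
    less : rot t + rot (P i) < rot t + (P (suc r) + Q (suc r))
    less = +-monoʳ-< (rot t) (subst (_< P (suc r) + Q (suc r)) (sym above) (m<m+n (P (suc r)) (1≤Q {suc r} (s≤s z≤n))))

  jump-below : ∀ {i t} → i < K → 1 ≤ t → t < P i → rot (t + Q (suc i)) + M ≡ rot t + rot (Q (suc i))
  jump-below {i} {t} i<K 1≤t t<P with m≤n⇒∃[o]m+o≡n i<K
  ... | r , 1+i+r≡K = rot-+-large t (Q (suc i)) (begin
    M                                   ≡⟨ below (s≤s z≤n) ⟨
    rot (Q (suc i)) + Q (suc r)         ≤⟨ +-monoʳ-≤ (rot (Q (suc i))) (≤-trans (m≤n+m (Q (suc r)) (P (suc r))) (proj₁ (awayᴾ 1≤t t<P))) ⟩
    rot (Q (suc i)) + rot t             ≡⟨ +-comm (rot (Q (suc i))) (rot t) ⟩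
    rot t + rot (Q (suc i))             ∎)
    where
    open ≤-Reasoning
    open Approach (approach i (suc r) (trans (+-suc i r) 1+i+r≡K))

  1≤rot : ∀ {t} → 1 ≤ t → t < M → 1 ≤ rot t
  1≤rot 1≤t t<M = proj₁ (Approach.awayᵠ (approach K 0 (+-identityʳ K)) 1≤t t<M)

  -- A form of Cassini's identity: the gap below M at `Q K` is `Q 1`, which is 1.
  rot-Q[K] : rot (Q K) + 1 ≡ M
  rot-Q[K] with m≤n⇒∃[o]m+o≡n 1≤K
  ... | k , 1+k≡K = subst (λ i → rot (Q i) + 1 ≡ M) 1+k≡K
    (Approach.below (approach k 1 (trans (+-comm k 1) 1+k≡K)) ≤-refl)

  Q[K]<M : Q K < M
  Q[K]<M = m<n+m (Q K) (1≤P K)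

-- Letters of a sequence of N blocks of length B, numbered down from N to 1,
-- that is followed by zeros.
module Blocks (B : ℕ) (letter : ℕ → ℕ → ℕ) where

  blocks : ℕ → ℕ → ℕ
  blocks zero    p = 0
  blocks (suc N) p with p <? B
  ... | yes _ = letter (suc N) p
  ... | no  _ = blocks N (p ∸ B)

  blocks-at : ∀ N q {o} → q < N → o < B → blocks N (q * B + o) ≡ letter (N ∸ q) o
  blocks-at (suc N) zero {o} _ o<B with o <? B
  ... | yes _   = refl
  ... | no  o≮B = contradiction o<B o≮B
  blocks-at (suc N) (suc q) {o} (s≤s q<N) o<B with B + q * B + o <? B
  ... | yes p<B = contradiction p<B (≤⇒≯ (≤-trans (m≤m+n B (q * B)) (m≤m+n (B + q * B) o)))
  ... | no  _   = trans (cong (blocks N) (trans (cong (_∸ B) (+-assoc B (q * B) o)) (m+n∸m≡n B (q * B + o))))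
                    (blocks-at N q q<N o<B)

  blocks-after : ∀ N {p} → N * B ≤ p → blocks N p ≡ 0
  blocks-after zero    _ = refl
  blocks-after (suc N) {p} NB≤p with p <? B
  ... | yes p<B = contradiction p<B (≤⇒≯ (≤-trans (m≤m+n B (N * B)) NB≤p))
  ... | no  _   = blocks-after N (subst (_≤ p ∸ B) (m+n∸m≡n B (N * B)) (∸-monoˡ-≤ B NB≤p))

  block-of : ∀ N p → N * B ≤ p ⊎ ∃ λ q → ∃ λ o → q < N × o < B × p ≡ q * B + o
  block-of zero    p = inj₁ z≤n
  block-of (suc N) p with p <? B
  ... | yes p<B = inj₂ (0 , p , s≤s z≤n , p<B , refl)
  ... | no  p≮B with block-of N (p ∸ B)
  ...   | inj₁ after = inj₁ (subst (B + N * B ≤_) (m+[n∸m]≡n (≮⇒≥ p≮B)) (+-monoʳ-≤ B after))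
  ...   | inj₂ (q , o , q<N , o<B , p∸B≡) = inj₂ (suc q , o , s≤s q<N , o<B ,
          trans (sym (m+[n∸m]≡n (≮⇒≥ p≮B))) (trans (cong (B +_) p∸B≡) (sym (+-assoc B (q * B) o))))

-- The word and the comparison of its suffixes

module Word (K : ℕ) (1≤K : 1 ≤ K) where

  open Fibonacci K 1≤K

  -- Two periods of the rotation, so that a half shifted by `Q K` still fits into a block: it starts
  -- at distance `M ∸ 1 + Q K` from the end, which is less than `M + M`.
  B : ℕ
  B = M + M

  letter : ℕ → ℕ → ℕ
  letter h zero    = 0
  letter h (suc o) = h + rot (B ∸ suc o)

  open Blocks B letter

  -- With M blocks, the 2 M letters of the first block, which may all be LZ phrases, cost only a
  -- constant per block.
  w : ℕ → ℕ
  w = blocks M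

  1≤M : 1 ≤ M
  1≤M = 1≤Q {suc K} (s≤s z≤n)

  w-end : ∀ q → w (q * B) ≡ 0
  w-end q with q <? M
  ... | yes q<M = trans (cong w (sym (+-identityʳ (q * B)))) (blocks-at M q q<M (≤-trans 1≤M (m≤m+n M M)))
  ... | no  q≮M = blocks-after M (*-monoˡ-≤ B (≮⇒≥ q≮M))

  w-inside : ∀ {q j p} → q < M → 1 ≤ j → j < B → p + j ≡ suc q * B → w p ≡ (M ∸ q) + rot j
  w-inside {q} {j} {p} q<M 1≤j j<B p+j≡ with m≤n⇒∃[o]m+o≡n j<B
  ... | o , 1+j+o≡B = begin
    w p                                   ≡⟨ cong w p≡ ⟩
    w (q * B + suc o)                     ≡⟨ blocks-at M q q<M o<B ⟩
    (M ∸ q) + rot (B ∸ suc o)             ≡⟨ cong (λ x → (M ∸ q) + rot (x ∸ suc o)) o+j≡B ⟨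
    (M ∸ q) + rot (suc o + j ∸ suc o)     ≡⟨ cong (λ x → (M ∸ q) + rot x) (m+n∸m≡n (suc o) j) ⟩
    (M ∸ q) + rot j                       ∎
    where
    open ≡-Reasoning
    o+j≡B : suc o + j ≡ B
    o+j≡B = trans (cong suc (+-comm o j)) 1+j+o≡B
    o<B : suc o < B
    o<B = subst (suc o <_) o+j≡B (m<m+n (suc o) 1≤j)
    p≡ : p ≡ q * B + suc o
    p≡ = +-cancelʳ-≡ j p (q * B + suc o) (begin
      p + j                  ≡⟨ p+j≡ ⟩
      B + q * B              ≡⟨ +-comm B (q * B) ⟩
      q * B + B              ≡⟨ cong (q * B +_) o+j≡B ⟨
      q * B + (suc o + j)    ≡⟨ +-assoc (q * B) (suc o) j ⟨
      q * B + suc o + j      ∎)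

  w-cases : ∀ p → w p ≡ 0 ⊎ ∃ λ q → ∃ λ j → q < M × 1 ≤ j × j < B × p + j ≡ suc q * B
  w-cases p with block-of M p
  ... | inj₁ after = inj₁ (blocks-after M after)
  ... | inj₂ (q , zero , _ , _ , refl) = inj₁ (trans (cong w (+-identityʳ (q * B))) (w-end q))
  ... | inj₂ (q , suc o , q<M , o<B , refl) with m≤n⇒∃[o]m+o≡n o<B
  ...   | j , 2+o+j≡B = inj₂ (q , suc j , q<M , s≤s z≤n , j<B , (begin
    q * B + suc o + suc j     ≡⟨ +-assoc (q * B) (suc o) (suc j) ⟩
    q * B + (suc o + suc j)   ≡⟨ cong (q * B +_) o+j≡B ⟩
    q * B + B                 ≡⟨ +-comm (q * B) B ⟩
    B + q * B                 ∎))
    where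
    open ≡-Reasoning
    o+j≡B : suc o + suc j ≡ B
    o+j≡B = trans (+-suc (suc o) j) 2+o+j≡B
    j<B : suc j < B
    j<B = subst (suc j <_) o+j≡B (m<n+m (suc j) (s≤s z≤n))

  w-within : ∀ {q m I} → q < M → I < B → m + I ≡ suc q * B →
    ∀ {s t} → s + t ≡ I → 1 ≤ t → w (m + s) ≡ (M ∸ q) + rot t
  w-within {m = m} {I} q<M I<B m+I≡ {s} {t} s+t≡I 1≤t =
    w-inside q<M 1≤t (≤-<-trans (subst (t ≤_) s+t≡I (m≤n+m t s)) I<B)
      (trans (+-assoc m s t) (trans (cong (m +_) s+t≡I) m+I≡))

  w-finish : ∀ q {p} → p ≡ suc q * B → w p ≡ 0
  w-finish q refl = w-end (suc q)

  positive : ∀ {h t} → 0 < h → h + t ≢ 0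
  positive {suc h} _ ()

  -- Refutes that a smaller suffix at p shares c > y letters with the suffix at m,
  -- where J and I are the distances to the ends of their blocks.
  module Compare {n q q′ m p J c i : ℕ} (MB<n : M * B < n) (i<K : i < K)
    (q<M : q < M) (m+I≡ : m + P (suc i) ≡ suc q * B) (I<B : P (suc i) < B)
    (q′<M : q′ < M) (p+J≡ : p + J ≡ suc q′ * B) (1≤J : 1 ≤ J) (J<B : J < B)
    (agree : Agree w m p c) (m+c<n : m + c < n) (less : p + c < n → w (p + c) < w (m + c))
    (y<c : Q (suc i) < c) where

    x = P i
    y = Q (suc i)
    I = P (suc i)
    h = M ∸ q
    h′ = M ∸ q′

    x≤y : x ≤ y
    x≤y = m≤m+n (P i) (Q i)

    letter-m : ∀ {s t} → s + t ≡ I → 1 ≤ t → w (m + s) ≡ h + rot t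
    letter-m = w-within q<M I<B m+I≡

    letter-p : ∀ {s t} → s + t ≡ J → 1 ≤ t → w (p + s) ≡ h′ + rot t
    letter-p = w-within q′<M J<B p+J≡

    -- The padding has at least one letter, so even the last block is followed by a 0 inside the
    -- word.
    p+J<n : p + J < n
    p+J<n = ≤-<-trans (≤-trans (≤-reflexive p+J≡) (*-monoˡ-≤ B q′<M)) MB<n

    0<h : 0 < h
    0<h = m<n⇒0<n∸m q<M

    0<h′ : 0 < h′
    0<h′ = m<n⇒0<n∸m q′<M

    -- More than y of the I = x + y letters have been passed, so the remaining distance is in the
    -- range of the jump lemmas.
    near : ∀ {t} → c + t ≡ I → t < x
    near {t} c+t≡I = +-cancelʳ-< y t x (subst (t + y <_) (trans (+-comm t c) c+t≡I) (+-monoʳ-< t y<c))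

    -- At equal distances the equal first letters reveal equal offsets, so p and m coincide, and no
    -- suffix is smaller than itself.
    same : J ≢ I
    same refl = contradiction (less (subst (λ a → a + c < n) (sym p≡m) m+c<n)) (<-irrefl (cong (λ a → w (a + c)) p≡m))
      where
      h≡h′ : h ≡ h′
      h≡h′ = +-cancelʳ-≡ (rot I) h h′
        (trans (sym (letter-m {0} refl 1≤J)) (trans (agree 0 (≤-<-trans z≤n y<c)) (letter-p {0} refl 1≤J)))
      p≡m : p ≡ m
      p≡m = +-cancelʳ-≡ I p m (trans p+J≡ (trans (cong (λ a → suc a * B)
        (sym (∸-cancelˡ-≡ (<⇒≤ q<M) (<⇒≤ q′<M) h≡h′))) (sym m+I≡)))

    -- The letter x positions before the mismatch exceeds the one at the mismatch by
    -- rot x in the block of m, but by at most rot x in the block of p.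
    smaller-letter : c < I → c ≮ J
    smaller-letter c<I c<J with m≤n⇒∃[o]m+o≡n c<I | m≤n⇒∃[o]m+o≡n c<J | m≤n⇒∃[o]m+o≡n (≤-trans x≤y (<⇒≤ y<c))
    ... | t , 1+c+t≡I | t′ , 1+c+t′≡J | s , x+s≡c = contradiction below (≤⇒≯ above)
      where
      open ≤-Reasoning
      c+t≡I : c + suc t ≡ I
      c+t≡I = trans (+-suc c t) 1+c+t≡I
      c+t′≡J : c + suc t′ ≡ J
      c+t′≡J = trans (+-suc c t′) 1+c+t′≡J
      below : h′ + rot (suc t′) < h + rot (suc t)
      below = subst₂ _<_ (letter-p c+t′≡J (s≤s z≤n)) (letter-m c+t≡I (s≤s z≤n))
        (less (<-trans (+-monoʳ-< p c<J) p+J<n))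
      s<c : s < c
      s<c = subst (s <_) x+s≡c (m<n+m s (1≤P i))
      split : ∀ {t d} → c + t ≡ d → s + (t + x) ≡ d
      split {t} {d} c+t≡d = begin-equality
        s + (t + x)  ≡⟨ cong (s +_) (+-comm t x) ⟩
        s + (x + t)  ≡⟨ +-assoc s x t ⟨
        s + x + t    ≡⟨ cong (_+ t) (trans (+-comm s x) x+s≡c) ⟩
        c + t        ≡⟨ c+t≡d ⟩
        d            ∎
      above : h + rot (suc t) ≤ h′ + rot (suc t′)
      above = +-cancelʳ-≤ (rot x) _ _ (begin
        h + rot (suc t) + rot x         ≡⟨ +-assoc h (rot (suc t)) (rot x) ⟩
        h + (rot (suc t) + rot x)       ≡⟨ cong (h +_) (jump-above i<K (s≤s z≤n) (near c+t≡I)) ⟨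
        h + rot (suc t + x)             ≡⟨ letter-m (split c+t≡I) (s≤s z≤n) ⟨
        w (m + s)                       ≡⟨ agree s s<c ⟩
        w (p + s)                       ≡⟨ letter-p (split c+t′≡J) (s≤s z≤n) ⟩
        h′ + rot (suc t′ + x)           ≤⟨ +-monoʳ-≤ h′ (rot-+-≤ (suc t′) x) ⟩
        h′ + (rot (suc t′) + rot x)     ≡⟨ +-assoc h′ (rot (suc t′)) (rot x) ⟨
        h′ + rot (suc t′) + rot x       ∎)

    -- The block of p ends at the mismatch. The letters x positions earlier, where the rotation does
    -- not wrap, give `h + rot (suc t) ≡ h′`; those y positions earlier, where it wraps, give the
    -- same equation off by M.
    cut-off : c ≡ J → J ≮ I
    cut-off refl J<I with m≤n⇒∃[o]m+o≡n J<I | m≤n⇒∃[o]m+o≡n (≤-trans x≤y (<⇒≤ y<c)) | m≤n⇒∃[o]m+o≡n (<⇒≤ y<c)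
    ... | t , 1+c+t≡I | s , x+s≡c | s′ , y+s′≡c = contradiction (+-cancelˡ-≡ (h + rot (suc t + y)) M 0 loop) λ M≡0 →
      contradiction 1≤M (≤⇒≯ (≤-reflexive M≡0))
      where
      open ≡-Reasoning
      c+t≡I : c + suc t ≡ I
      c+t≡I = trans (+-suc c t) 1+c+t≡I
      step : ∀ {z s} → 1 ≤ z → z + s ≡ c → h + rot (suc t + z) ≡ h′ + rot z
      step {z} {s} 1≤z z+s≡c = begin
        h + rot (suc t + z)   ≡⟨ letter-m s+t+z≡I (s≤s z≤n) ⟨
        w (m + s)             ≡⟨ agree s (subst (s <_) z+s≡c (m<n+m s 1≤z)) ⟩
        w (p + s)             ≡⟨ letter-p (trans (+-comm s z) z+s≡c) 1≤z ⟩
        h′ + rot z            ∎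
        where
        s+t+z≡I : s + (suc t + z) ≡ I
        s+t+z≡I = begin
          s + (suc t + z)  ≡⟨ cong (s +_) (+-comm (suc t) z) ⟩
          s + (z + suc t)  ≡⟨ +-assoc s z (suc t) ⟨
          s + z + suc t    ≡⟨ cong (_+ suc t) (trans (+-comm s z) z+s≡c) ⟩
          c + suc t        ≡⟨ c+t≡I ⟩
          I                ∎
      h+t≡h′ : h + rot (suc t) ≡ h′
      h+t≡h′ = +-cancelʳ-≡ (rot x) _ _ (begin
        h + rot (suc t) + rot x     ≡⟨ +-assoc h (rot (suc t)) (rot x) ⟩
        h + (rot (suc t) + rot x)   ≡⟨ cong (h +_) (jump-above i<K (s≤s z≤n) (near c+t≡I)) ⟨
        h + rot (suc t + x)         ≡⟨ step (1≤P i) x+s≡c ⟩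
        h′ + rot x                  ∎)
      loop : h + rot (suc t + y) + M ≡ h + rot (suc t + y) + 0
      loop = begin
        h + rot (suc t + y) + M     ≡⟨ +-assoc h (rot (suc t + y)) M ⟩
        h + (rot (suc t + y) + M)   ≡⟨ cong (h +_) (jump-below i<K (s≤s z≤n) (near c+t≡I)) ⟩
        h + (rot (suc t) + rot y)   ≡⟨ +-assoc h (rot (suc t)) (rot y) ⟨
        h + rot (suc t) + rot y     ≡⟨ cong (_+ rot y) h+t≡h′ ⟩
        h′ + rot y                  ≡⟨ step (1≤Q {suc i} (s≤s z≤n)) y+s′≡c ⟨
        h + rot (suc t + y)         ≡⟨ +-identityʳ _ ⟨
        h + rot (suc t + y) + 0     ∎

    -- Agreement beyond the block end that comes first would equate 0 with a positive letter, and a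
    -- mismatch at the end of the block of m would need a letter below 0. The earlier lemmas exclude
    -- the other cases.
    impossible : ⊥
    impossible with <-cmp J I
    ... | tri≈ _ J≡I _ = same J≡I
    ... | tri< J<I _ _ with <-cmp c J
    ...   | tri< c<J _ _ = smaller-letter (<-trans c<J J<I) c<J
    ...   | tri≈ _ c≡J _ = cut-off c≡J J<I
    ...   | tri> _ _ J<c with m≤n⇒∃[o]m+o≡n J<I
    ...     | t , 1+J+t≡I = positive 0<h
              (trans (sym (letter-m (trans (+-suc J t) 1+J+t≡I) (s≤s z≤n))) (trans (agree J J<c) (w-finish q′ p+J≡)))
    impossible | tri> _ _ I<J with <-cmp c I
    ...   | tri< c<I _ _ = smaller-letter c<I (<-trans c<I I<J)
    ...   | tri≈ _ refl _ = n≮0 (subst (w (p + I) <_) (w-finish q m+I≡) (less (<-trans (+-monoʳ-< p I<J) p+J<n)))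
    ...   | tri> _ _ I<c with m≤n⇒∃[o]m+o≡n I<J
    ...     | t , 1+I+t≡J = positive 0<h′
              (trans (sym (letter-p (trans (+-suc I t) 1+I+t≡J) (s≤s z≤n))) (trans (sym (agree I I<c)) (w-finish q m+I≡)))

  -- Lower bound for the lex-parse

  P≤P[K] : ∀ {i} → i ≤ K → P i ≤ P K
  P≤P[K] {i} i≤K with m≤n⇒∃[o]m+o≡n i≤K
  ... | d , refl = go d
    where
    go : ∀ d → P i ≤ P (i + d)
    go zero    = ≤-reflexive (cong P (sym (+-identityʳ i)))
    go (suc d) = ≤-trans (go d) (subst (λ k → P (i + d) ≤ P k) (sym (+-suc i d)) (m≤m+n (P (i + d)) (Q (suc (i + d)))))

  P<B : ∀ {i} → i ≤ K → P i < B
  P<B i≤K = ≤-<-trans (≤-trans (P≤P[K] i≤K) (m≤m+n (P K) (Q K))) (m<m+n M 1≤M)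

  lex-bound : ∀ {n q m i} → M * B < n → i < K → q < M → m + P (suc i) ≡ suc q * B →
    ∀ p c → Below w <-isStrictTotalOrder n m p c → c ≤ Q (suc i)
  lex-bound {q = q} {m} {i} MB<n i<K q<M m+I≡ p c (agree , m+c<n , _ , less) with c ≤? Q (suc i)
  ... | yes c≤y = c≤y
  ... | no  c≰y with w-cases p
  ...   | inj₁ wp≡0 = contradiction (trans (trans (sym (w-within q<M (P<B i<K) m+I≡ {0} refl (1≤P (suc i))))
            (agree 0 (≤-<-trans z≤n (≰⇒> c≰y)))) (trans (cong w (+-identityʳ p)) wp≡0)) (positive (m<n⇒0<n∸m q<M))
  ...   | inj₂ (q′ , J , q′<M , 1≤J , J<B , p+J≡) = ⊥-elim
          (Compare.impossible MB<n i<K q<M m+I≡ (P<B i<K) q′<M p+J≡ 1≤J J<B agree m+c<n less (≰⇒> c≰y))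

  module _ {n : ℕ} (MB<n : M * B < n) where

    private
      open LexParse <-isStrictTotalOrder using (ℓ; v) renaming (phraseLength to lexLength)
      open IsStrictTotalOrder <-isStrictTotalOrder using (_≟_)

      W : List ℕ
      W = word w n

    LexAtLeast : ℕ → ℕ → Set
    LexAtLeast = AtLeast (lexLength W) W

    weaken : ∀ {m m′ R} → m′ ≤ m → LexAtLeast m R → LexAtLeast m′ R
    weaken m′≤m h b k b≤m′ = h b k (≤-trans b≤m′ m′≤m)

    mark : ℕ → ℕ → ℕ
    mark q i = suc q * B ∸ P i

    mark+P : ∀ q {i} → i ≤ K → mark q i + P i ≡ suc q * B
    mark+P q i≤K = m∸n+n≡m (≤-trans (<⇒≤ (P<B i≤K)) (m≤m+n B (q * B)))

    -- The marks for `suc i` and i are `Q (suc i)` apart, exactly as far as a phrase that starts at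
    -- or before the former can reach past it. So each step between marks accounts for one more
    -- phrase.
    marks : ∀ {q R} i → i ≤ K → q < M → LexAtLeast (mark q 0) R → LexAtLeast (mark q i) (i + R)
    marks zero    _   _   rest = rest
    marks {q} (suc i) i<K q<M rest =
      atLeast-step (lexLength W) W (λ b → m≤n⊔m (ℓ W b) 1)
        (subst (mark q (suc i) <_) (sym (length-word w n)) m<n)
        (λ b b≤m → ≤-trans
          (phrase-stops w <-isStrictTotalOrder m<n (1≤Q {suc i} (s≤s z≤n)) (lex-bound MB<n i<K q<M (mark+P q i<K)) b b≤m)
          (≤-reflexive step))
        (marks i (<⇒≤ i<K) q<M rest)
      where
      open ≡-Reasoning
      m<n : mark q (suc i) < n
      m<n = ≤-<-trans (m∸n≤m (suc q * B) (P (suc i))) (≤-<-trans (*-monoˡ-≤ B q<M) MB<n)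
      step : mark q (suc i) + Q (suc i) ≡ mark q i
      step = +-cancelʳ-≡ (P i) _ _ (begin
        mark q (suc i) + Q (suc i) + P i     ≡⟨ +-assoc (mark q (suc i)) (Q (suc i)) (P i) ⟩
        mark q (suc i) + (Q (suc i) + P i)   ≡⟨ cong (mark q (suc i) +_) (+-comm (Q (suc i)) (P i)) ⟩
        mark q (suc i) + P (suc i)           ≡⟨ mark+P q i<K ⟩
        suc q * B                            ≡⟨ mark+P q (<⇒≤ i<K) ⟨
        mark q i + P i                       ∎)

    lex-blocks : ∀ d q → q + d ≡ M → LexAtLeast (q * B) (d * K)
    lex-blocks zero    q _ b k _ _ = z≤n
    lex-blocks (suc d) q q+d≡M = weaken q*B≤mark
      (marks K ≤-refl (subst (q <_) q+d≡M (m<m+n q (s≤s z≤n)))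
        (weaken (m∸n≤m (suc q * B) 1) (lex-blocks d (suc q) (trans (sym (+-suc q d)) q+d≡M))))
      where
      q*B≤mark : q * B ≤ mark q K
      q*B≤mark = +-cancelʳ-≤ (P K) _ _ (≤-trans (+-monoʳ-≤ (q * B) (<⇒≤ (P<B ≤-refl)))
        (≤-reflexive (trans (+-comm (q * B) B) (sym (mark+P q ≤-refl)))))

    M*K≤v : M * K ≤ v W
    M*K≤v = lex-blocks M 0 refl 0 (length W) z≤n ≤-refl

    -- Upper bound for the LZ factorization

    LZ≤ : ℕ → ℕ → Set
    LZ≤ = LZAtMost w _≟_ n

    1+M∸1≡M : 1 + (M ∸ 1) ≡ M
    1+M∸1≡M = m+[n∸m]≡n 1≤M

    first-half : ∀ {q} → q < M → ∀ s {t} → 1 ≤ t → s + t ≡ M ∸ 1 → w (q * B + 1 + s) ≡ (M ∸ q) + rot t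
    first-half {q} q<M s {t} 1≤t s+t≡ = trans
      (w-inside q<M (≤-trans 1≤t (m≤n+m t M)) (+-monoʳ-< M t<M) position) (cong ((M ∸ q) +_) (rot-period t))
      where
      1+s+t≡M : 1 + (s + t) ≡ M
      1+s+t≡M = trans (cong suc s+t≡) 1+M∸1≡M
      t<M : t < M
      t<M = subst (t <_) 1+s+t≡M (s≤s (m≤n+m t s))
      lemma : ∀ a m s t → a + 1 + s + (m + t) ≡ m + (1 + (s + t)) + a
      lemma = solve-∀
      position : q * B + 1 + s + (M + t) ≡ suc q * B
      position = trans (lemma (q * B) M s t) (cong (λ x → M + x + q * B) 1+s+t≡M)

    second-half : ∀ {q} → q < M → ∀ s {t} → 1 ≤ t → s + t ≡ M ∸ 1 → w (q * B + M + 1 + s) ≡ (M ∸ q) + rot t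
    second-half {q} q<M s {t} 1≤t s+t≡ = w-inside q<M 1≤t (≤-trans t<M (m≤m+n M M)) position
      where
      1+s+t≡M : 1 + (s + t) ≡ M
      1+s+t≡M = trans (cong suc s+t≡) 1+M∸1≡M
      t<M : t < M
      t<M = subst (t <_) 1+s+t≡M (s≤s (m≤n+m t s))
      lemma : ∀ a m s t → a + m + 1 + s + t ≡ m + (1 + (s + t)) + a
      lemma = solve-∀
      position : q * B + M + 1 + s + t ≡ suc q * B
      position = trans (lemma (q * B) M s t) (cong (λ x → M + x + q * B) 1+s+t≡M)

    agree-halves : ∀ {q} → q < M → Agree w (q * B + M + 1) (q * B + 1) (M ∸ 1)
    agree-halves q<M s s<M∸1 with m≤n⇒∃[o]m+o≡n s<M∸1
    ... | t , 1+s+t≡ = trans (second-half q<M s (s≤s z≤n) s+t≡) (sym (first-half q<M s (s≤s z≤n) s+t≡))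
      where
      s+t≡ : s + suc t ≡ M ∸ 1
      s+t≡ = trans (+-suc s t) 1+s+t≡

    -- Adding Q K to the argument of rot lowers the value by 1, which makes up for
    -- the larger offset of the preceding block.
    agree-blocks : ∀ {q} → suc q < M → Agree w (suc q * B + 1) (suc q * B ∸ (M ∸ 1 + Q K)) (M ∸ 1)
    agree-blocks {q} 1+q<M s s<M∸1 with m≤n⇒∃[o]m+o≡n s<M∸1
    ... | t , 1+s+t≡ = begin
      w (suc q * B + 1 + s)                  ≡⟨ first-half 1+q<M s (s≤s z≤n) s+t≡ ⟩
      (M ∸ suc q) + rot (suc t)              ≡⟨ cong ((M ∸ suc q) +_) lower ⟨
      (M ∸ suc q) + (1 + rot (suc t + Q K))  ≡⟨ +-suc (M ∸ suc q) (rot (suc t + Q K)) ⟩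
      1 + (M ∸ suc q) + rot (suc t + Q K)    ≡⟨ cong (_+ rot (suc t + Q K)) (+-∸-assoc 1 (<⇒≤ 1+q<M)) ⟨
      (M ∸ q) + rot (suc t + Q K)            ≡⟨ w-inside (<-trans (n<1+n q) 1+q<M) (s≤s z≤n) (+-mono-< t<M Q[K]<M) position ⟨
      w (σ + s)                              ∎
      where
      open ≡-Reasoning
      σ = suc q * B ∸ (M ∸ 1 + Q K)
      s+t≡ : s + suc t ≡ M ∸ 1
      s+t≡ = trans (+-suc s t) 1+s+t≡
      t<M : suc t < M
      t<M = subst (suc t <_) 1+M∸1≡M (s≤s (subst (suc t ≤_) s+t≡ (m≤n+m (suc t) s)))
      lemma₁ : ∀ a s t u → a + s + (t + u) ≡ a + (s + t + u)
      lemma₁ = solve-∀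
      lemma₂ : ∀ a b → 1 + a + b ≡ a + (b + 1)
      lemma₂ = solve-∀
      position : σ + s + (suc t + Q K) ≡ suc q * B
      position = begin
        σ + s + (suc t + Q K)     ≡⟨ lemma₁ σ s (suc t) (Q K) ⟩
        σ + (s + suc t + Q K)     ≡⟨ cong (λ x → σ + (x + Q K)) s+t≡ ⟩
        σ + (M ∸ 1 + Q K)         ≡⟨ m∸n+n≡m (≤-trans (+-mono-≤ (m∸n≤m M 1) (<⇒≤ Q[K]<M)) (m≤m+n B (q * B))) ⟩
        suc q * B                 ∎
      large : M ≤ rot (suc t) + rot (Q K)
      large = ≤-trans (≤-reflexive (trans (sym rot-Q[K]) (+-comm (rot (Q K)) 1))) (+-monoˡ-≤ (rot (Q K)) (1≤rot (s≤s z≤n) t<M))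
      lower : 1 + rot (suc t + Q K) ≡ rot (suc t)
      lower = +-cancelʳ-≡ (rot (Q K)) _ _ (begin
        1 + rot (suc t + Q K) + rot (Q K)     ≡⟨ lemma₂ (rot (suc t + Q K)) (rot (Q K)) ⟩
        rot (suc t + Q K) + (rot (Q K) + 1)   ≡⟨ cong (rot (suc t + Q K) +_) rot-Q[K] ⟩
        rot (suc t + Q K) + M                 ≡⟨ rot-+-large (suc t) (Q K) large ⟩
        rot (suc t) + rot (Q K)               ∎)

    letter-then : ∀ {a R} → LZ≤ (a + 1) R → LZ≤ a (suc R)
    letter-then {a} {R} rest = lzAtMost-letter w _≟_ (subst (λ i → LZ≤ i R) (+-comm a 1) rest)

    +1+[M∸1] : ∀ a → a + 1 + (M ∸ 1) ≡ a + M
    +1+[M∸1] a = trans (+-assoc a 1 (M ∸ 1)) (cong (a +_) 1+M∸1≡M)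

    half-then : ∀ {a σ R} → a + M ≤ n → σ < a + 1 → Agree w (a + 1) σ (M ∸ 1) → LZ≤ (a + M) R → LZ≤ (a + 1) (suc R)
    half-then {a} {σ} {R} a+M≤n σ<a+1 eq rest = lzAtMost-copy w _≟_ (subst (_≤ n) (sym (+1+[M∸1] a)) a+M≤n) σ<a+1 eq
      (subst (λ i → LZ≤ i R) (sym (+1+[M∸1] a)) rest)

    -- Four stretches with at most one phrase start each: the leading 0, the first half copied from
    -- the preceding block, the single letter at distance M from the end, and the second half copied
    -- from the first.
    lz-block : ∀ {q R} → suc q < M → LZ≤ (suc (suc q) * B) R → LZ≤ (suc q * B) (4 + R)
    lz-block {q} {R} 1+q<M rest =
      letter-then (half-then (≤-trans (m≤m+n (S + M) M) end≤n)
        (≤-<-trans (m∸n≤m S (M ∸ 1 + Q K)) (m<m+n S (s≤s z≤n))) (agree-blocks 1+q<M)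
        (letter-then (half-then end≤n (+-monoˡ-< 1 (m<m+n S 1≤M)) (agree-halves 1+q<M)
          (subst (λ i → LZ≤ i R) (sym end) rest))))
      where
      S = suc q * B
      end : S + M + M ≡ suc (suc q) * B
      end = trans (+-assoc S M M) (+-comm S B)
      end≤n : S + M + M ≤ n
      end≤n = ≤-trans (≤-reflexive end) (≤-trans (*-monoˡ-≤ B 1+q<M) (<⇒≤ MB<n))

    lz-blocks : ∀ d q → suc q + d ≡ M → LZ≤ (M * B) 2 → LZ≤ (suc q * B) (d * 4 + 2)
    lz-blocks zero    q 1+q≡M   rest = subst (λ i → LZ≤ (i * B) 2) (trans (sym 1+q≡M) (+-identityʳ (suc q))) rest
    lz-blocks (suc d) q 1+q+d≡M rest = lz-block (subst (suc q <_) 1+q+d≡M (m<m+n (suc q) (s≤s z≤n)))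
      (lz-blocks d (suc q) (trans (sym (+-suc (suc q) d)) 1+q+d≡M) rest)

    -- After its first 0, the padding is an overlapping copy of itself shifted by one position.
    lz-padding : LZ≤ (M * B) 2
    lz-padding with m≤n⇒∃[o]m+o≡n MB<n
    ... | d , 1+MB+d≡n = lzAtMost-letter w _≟_ (lzAtMost-copy w _≟_ (≤-reflexive 1+MB+d≡n) (n<1+n (M * B))
      (λ s _ → trans (blocks-after M (≤-trans (n≤1+n (M * B)) (m≤m+n (suc (M * B)) s)))
                 (sym (blocks-after M (m≤m+n (M * B) s))))
      (subst (λ i → LZ≤ i 0) (sym 1+MB+d≡n) (lzAtMost-end w _≟_ n)))

    -- The first block is charged one phrase per letter, each other block four, and the padding two.
    z≤8M : LZ.z _≟_ W ≤ 8 * M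
    z≤8M = ≤-trans (from-0 0 (length W) z≤n) (begin
      B + ((M ∸ 1) * 4 + 2)        ≤⟨ +-monoʳ-≤ B (+-monoʳ-≤ ((M ∸ 1) * 4) (s≤s (s≤s (z≤n {2})))) ⟩
      B + ((M ∸ 1) * 4 + 4)        ≡⟨ cong (B +_) (+-comm ((M ∸ 1) * 4) 4) ⟩
      B + (1 + (M ∸ 1)) * 4        ≡⟨ cong (λ x → B + x * 4) 1+M∸1≡M ⟩
      M + M + M * 4                ≤⟨ m≤m+n (M + M + M * 4) (M + M) ⟩
      M + M + M * 4 + (M + M)      ≡⟨ lemma M ⟩
      8 * M                        ∎)
      where
      open ≤-Reasoning
      lemma : ∀ m → m + m + m * 4 + (m + m) ≡ 8 * m
      lemma = solve-∀
      from-0 : LZ≤ 0 (B + ((M ∸ 1) * 4 + 2))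
      from-0 = lzAtMost-letters w _≟_ B (subst (λ i → LZ≤ i ((M ∸ 1) * 4 + 2)) (trans (*-identityˡ B) (sym (+-identityʳ B)))
        (lz-blocks (M ∸ 1) 0 1+M∸1≡M lz-padding))

-- Choice of K and the final estimate

-- As M is at most 4 ^ K, the blocks occupy at most 2 ^ (4 K + 1) letters, and 4 K + 1 < 8 K for
-- positive K.
blocks-fit : ∀ {K} → 1 ≤ K → Q (suc K) * (Q (suc K) + Q (suc K)) < 256 ^ K
blocks-fit {K} 1≤K = begin-strict
  m * (m + m)                               ≤⟨ *-mono-≤ m≤ (+-mono-≤ m≤ m≤) ⟩
  2 ^ (2 * K) * (2 ^ (2 * K) + 2 ^ (2 * K)) ≡⟨ lemma₁ (2 ^ (2 * K)) ⟩
  2 ^ (2 * K) * 2 ^ suc (2 * K)             ≡⟨ ^-distribˡ-+-* 2 (2 * K) (suc (2 * K)) ⟨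
  2 ^ (2 * K + suc (2 * K))                 <⟨ ^-monoʳ-< 2 (s≤s (s≤s z≤n)) exponent ⟩
  2 ^ (8 * K)                               ≡⟨ ^-*-assoc 2 8 K ⟨
  256 ^ K                                   ∎
  where
  open ≤-Reasoning
  m = Q (suc K)
  m≤ : m ≤ 2 ^ (2 * K)
  m≤ = ≤-trans (P+Q≤4^ K) (≤-reflexive (^-*-assoc 2 2 K))
  lemma₁ : ∀ x → x * (x + x) ≡ x * (2 * x)
  lemma₁ = solve-∀
  lemma₂ : ∀ k → 2 * k + suc (2 * k) + (k + k + k) + k ≡ 8 * k + 1
  lemma₂ = solve-∀
  exponent : 2 * K + suc (2 * K) < 8 * K
  exponent = +-cancelʳ-< 1 _ _ (subst (2 * K + suc (2 * K) + 1 <_) (lemma₂ K)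
    (+-mono-<-≤ (m<m+n _ (≤-trans 1≤K (≤-trans (m≤m+n K K) (m≤m+n (K + K) K)))) 1≤K))

-- K is the integer part of the logarithm of n to base 256, found by lowering the crude bound j; n ≥
-- 256 makes it positive.
logarithm : ∀ j {n} → 256 ≤ n → n < 256 ^ j → ∃ λ K → 1 ≤ K × 256 ^ K ≤ n × n < 256 ^ suc K
logarithm zero    256≤n n<1 = contradiction (≤-trans (s≤s z≤n) 256≤n) (<⇒≱ n<1)
logarithm (suc j) {n} 256≤n n<256^1+j with n <? 256 ^ j
... | yes n<256^j = logarithm j 256≤n n<256^j
logarithm (suc zero)    256≤n n<256 | no _     = contradiction 256≤n (<⇒≱ n<256)
logarithm (suc (suc j)) 256≤n n<    | no n≮256^j = suc j , s≤s z≤n , ≮⇒≥ n≮256^j , n<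

n<256^n : ∀ n → n < 256 ^ n
n<256^n zero    = s≤s z≤n
n<256^n (suc n) = begin-strict
  suc n                <⟨ s≤s (n<256^n n) ⟩
  1 + 256 ^ n          ≤⟨ +-monoˡ-≤ (256 ^ n) (m^n>0 256 n) ⟩
  256 ^ n + 256 ^ n    ≡⟨ cong (λ x → 256 ^ n + x) (+-identityʳ (256 ^ n)) ⟨
  2 * 256 ^ n          ≤⟨ *-monoˡ-≤ (256 ^ n) (s≤s (s≤s (z≤n {254}))) ⟩
  256 * 256 ^ n        ∎
  where open ≤-Reasoning

theorem20 : ∃ λ (κ : ℚ) → κ > 0ℚ × ∃ λ (n₀ : ℕ) → (n : ℕ) → n₀ ≤ n →
    ∃ λ (A : Set) → ∃ λ (_≺_ : Rel A 0ℓ) → ∃ λ (O : IsStrictTotalOrder _≡_ _≺_) →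
    ∃ λ (W : List A) → length W ≡ n ×
    LexParse.v O W ≥ κ ·log₂ n · LZ.z (IsStrictTotalOrder._≟_ O) W
theorem20 = ℤ.+ 1 / 128 , *<* (ℤ.+<+ (s≤s z≤n)) , 256 , λ n 256≤n →
  let K , 1≤K , 256^K≤n , n<256^1+K = logarithm n 256≤n (n<256^n n)
      MB<n = <-≤-trans (blocks-fit 1≤K) 256^K≤n
  in ℕ , _<_ , <-isStrictTotalOrder , word (Word.w K 1≤K) n , length-word (Word.w K 1≤K) n ,
     bound K {m = Q (suc K)} 1≤K n<256^1+K (Word.z≤8M K 1≤K MB<n) (Word.M*K≤v K 1≤K MB<n)
  where
  -- 128 = 8 · 16, where z ≤ 8 M and n < 2 ^ (8 (K + 1)) ≤ 2 ^ (16 K).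
  bound : ∀ K {n m y x} → 1 ≤ K → n < 256 ^ suc K → y ≤ 8 * m → m * K ≤ x → n ^ (1 * y) ≤ 2 ^ (128 * x)
  bound K {n} {m} {y} {x} 1≤K n< y≤8m mK≤x = begin
    n ^ (1 * y)                ≤⟨ ^-monoˡ-≤ (1 * y) (<⇒≤ n<) ⟩
    (256 ^ suc K) ^ (1 * y)    ≡⟨ cong (_^ (1 * y)) (^-*-assoc 2 8 (suc K)) ⟩
    (2 ^ (8 * suc K)) ^ (1 * y) ≡⟨ ^-*-assoc 2 (8 * suc K) (1 * y) ⟩
    2 ^ (8 * suc K * (1 * y))  ≤⟨ ^-monoʳ-≤ 2 exponent ⟩
    2 ^ (128 * x)              ∎
    where
    open ≤-Reasoning
    lemma₁ : ∀ k m → 8 * (k + k) * (1 * (8 * m)) ≡ 128 * (m * k)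
    lemma₁ = solve-∀
    exponent : 8 * suc K * (1 * y) ≤ 128 * x
    exponent = begin
      8 * suc K * (1 * y)        ≤⟨ *-mono-≤ (*-monoʳ-≤ 8 (+-monoˡ-≤ K 1≤K)) (*-monoʳ-≤ 1 y≤8m) ⟩
      8 * (K + K) * (1 * (8 * m)) ≡⟨ lemma₁ K m ⟩
      128 * (m * K)              ≤⟨ *-monoʳ-≤ 128 mK≤x ⟩
      128 * x                    ∎
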